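{- For every $k\ge1$, $\mathrm{ABD}(k\text{ -CNF})\le^{\mathrm{CV}}\mathrm{ABD}((k+1)\text{ -NAE})$ and $\mathrm{P\text{ - }ABD}(k\text{ -CNF})\le^{\mathrm{CV}}\mathrm{P\text{ - }ABD}((k+1)\text{ -NAE})$.
   Context: $k\text{ -CNF}$ is the constraint language of all clauses of arity $k$. For a sign pattern $s=(s_1,\dots,s_k)\in\{0,1\}^k$, let $0_s=(a_1,\dots,a_k)$ be the unique tuple with $s_i\oplus a_i=0$ for all $i$ and $1_s$ the unique tuple with $s_i\oplus a_i=1$ for all $i$, and let $R^s_{\mathrm{NAE}}=\{0,1\}^k\setminus\{0_s,1_s\}$. $k\text{ -NAE}$ is the set of all relations $R^s_{\mathrm{NAE}}$ of arity $k$. An instance of $\mathrm{ABD}(\Gamma)$ is $(\mathrm{KB},H,M)$, $\mathrm{KB}$ a $\Gamma$-formula, $H,M$ sets of variables; it asks whether there is $E\subseteq H\cup\{\neg x:x\in H\}$ with $\mathrm{KB}\wedge E$ satisfiable and $\mathrm{KB}\wedge E\models m$ for all $m\in M$; $\mathrm{P\text{ - }ABD}(\Gamma)$ additionally requires $E\subseteq H$. A CV-reduction $A\le^{\mathrm{CV}}B$ is a polynomial-time map $f$ with $I\in A\iff f(I)\in B$ and $|\mathrm{var}(f(I))|\le|\mathrm{var}(I)|+O(1)$. -}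

module Defs where

open import Data.Bool.Base using (Bool; true; false; not; _xor_; if_then_else_)
open import Data.Fin.Base using (Fin)
open import Data.List.Base using (List; []; _∷_; _++_; [_]; map; concatMap; length; reverse; catMaybes; deduplicate)
open import Data.List.Membership.Propositional using (_∈_)
open import Data.List.Relation.Binary.Subset.Propositional using (_⊆_)
open import Data.List.Relation.Unary.All using (All)
open import Data.Maybe.Base as Maybe using (Maybe; just; nothing)
open import Data.Nat.Base using (ℕ; suc; _+_; _*_; _^_; _≤_)
open import Data.Nat.Binary.Base using (ℕᵇ; 2[1+_]; 1+[2_]; fromℕ)
open import Data.Nat.Properties using (_≟_)
open import Data.Product.Base using (Σ; ∃-syntax; _×_; _,_)
open import Data.Sum.Base using (_⊎_; inj₁)
open import Data.Vec.Base as Vec using (Vec; lookup; toList)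
open import Function.Bundles using (_⇔_; _↔_)
open import Relation.Binary.PropositionalEquality.Core using (_≡_)
open import Relation.Nullary.Negation.Core using (¬_)

------------------------------------------------------------------------
-- Deterministic multi-tape Turing machines

data Move : Set where
  left stay right : Move

-- Two-way infinite tape; `nothing` is the blank, cells beyond the lists
-- are blank, and `before` lists the cells left of the head nearest first.
record Tape (A : Set) : Set where
  constructor tape
  field
    before : List (Maybe A)
    head   : Maybe A
    after  : List (Maybe A)

module _ {A : Set} where

  blankTape : Tape A
  blankTape = tape [] nothing []

  wordTape : List A → Tape A
  wordTape []       = blankTape
  wordTape (a ∷ as) = tape [] (just a) (map just as)

  move : Move → Tape A → Tape A
  move left  (tape []       c rs) = tape [] nothing (c ∷ rs)
  move left  (tape (l ∷ ls) c rs) = tape ls l (c ∷ rs)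
  move stay  t                    = t
  move right (tape ls c [])       = tape (c ∷ ls) nothing []
  move right (tape ls c (r ∷ rs)) = tape (c ∷ ls) r rs

  act : Tape A → Maybe A × Move → Tape A
  act (tape ls _ rs) (c , m) = move m (tape ls c rs)

  -- The non-blank symbols, from left to right.
  contents : Tape A → List A
  contents (tape ls c rs) = catMaybes (reverse ls ++ c ∷ rs)

-- A machine over the input/output alphabet A.  Tape 0 is the input tape,
-- tape 1 the output tape, and the others are work tapes.  The machine
-- halts when δ returns `nothing`.
record TuringMachine (A : Set) : Set₁ where
  field
    State        : Set
    state-finite : ∃[ n ] (State ↔ Fin n)
    auxSymbols   : ℕ
    workTapes    : ℕ

  Symbol : Set
  Symbol = A ⊎ Fin auxSymbols

  tapes : ℕ
  tapes = 2 + workTapes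

  field
    start : State
    δ     : State → Vec (Maybe Symbol) tapes →
            Maybe (State × Vec (Maybe Symbol × Move) tapes)

  Config : Set
  Config = State × Vec (Tape Symbol) tapes

  initial : List A → Config
  initial w = start , wordTape (map inj₁ w) Vec.∷ Vec.replicate _ blankTape

  step : Config → Maybe Config
  step (q , ts) = Maybe.map (λ (q′ , as) → q′ , Vec.zipWith act ts as)
                            (δ q (Vec.map Tape.head ts))

  output : Config → List Symbol
  output (_ , _ Vec.∷ out Vec.∷ _) = contents out

  infix 4 _⇓[_]_
  data _⇓[_]_ : Config → ℕ → Config → Set where
    halt : ∀ {c} → step c ≡ nothing → c ⇓[ 0 ] c
    next : ∀ {c c′ d t} → step c ≡ just c′ → c′ ⇓[ t ] d → c ⇓[ suc t ] d

  Computes_from_within_ : List A → List A → ℕ → Set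
  Computes v from w within b =
    ∃[ t ] ∃[ d ] (initial w ⇓[ t ] d × t ≤ b × output d ≡ map inj₁ v)

-- f is computed, relative to the encodings of its arguments and values,
-- by a machine whose running time is at most c * n ^ e + c for inputs
-- of length n.
PolyTime : {A X Y : Set} → (X → List A) → (Y → List A) → (X → Y) → Set₁
PolyTime {A} encX encY f =
  Σ (TuringMachine A) λ T → ∃[ c ] ∃[ e ] (∀ x →
    TuringMachine.Computes_from_within_ T
      (encY (f x)) (encX x) (c * length (encX x) ^ e + c))

------------------------------------------------------------------------
-- Problems whose instances have variables, and CV-reductions

data Letter : Set where
  𝟘 𝟙 comma colon semicolon slash : Letter

record Problem : Set₁ where
  field
    Instance : Set
    encode   : Instance → List Letter
    ∣var_∣   : Instance → ℕ
    Yes      : Instance → Set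

infix 4 _≤CV_
record _≤CV_ (A B : Problem) : Set₁ where
  private
    module A = Problem A
    module B = Problem B
  field
    f        : A.Instance → B.Instance
    polyTime : PolyTime A.encode B.encode f
    correct  : ∀ I → A.Yes I ⇔ B.Yes (f I)
    fewVars  : ∃[ c ] (∀ I → B.∣var f I ∣ ≤ A.∣var I ∣ + c)

------------------------------------------------------------------------
-- Boolean constraint languages

-- The relations of a language are referred to by names; `code` gives the
-- bit string standing for a name in encoded instances.
record Language : Set₁ where
  field
    Name  : Set
    arity : Name → ℕ
    Holds : (R : Name) → Vec Bool (arity R) → Set
    code  : Name → List Bool

SignPattern : ℕ → Set
SignPattern k = Vec Bool k

-- The clause with sign pattern s is the disjunction of the literals
-- sᵢ ⊕ xᵢ, so sᵢ = false is a positive and sᵢ = true a negative literal.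
Clause : ∀ {k} → SignPattern k → Vec Bool k → Set
Clause s a = ∃[ i ] (lookup s i xor lookup a i ≡ true)

Is0 Is1 : ∀ {k} → SignPattern k → Vec Bool k → Set
Is0 s a = ∀ i → lookup s i xor lookup a i ≡ false
Is1 s a = ∀ i → lookup s i xor lookup a i ≡ true

NAE : ∀ {k} → SignPattern k → Vec Bool k → Set
NAE s a = ¬ Is0 s a × ¬ Is1 s a

_-CNF : ℕ → Language
k -CNF = record
  { Name = SignPattern k ; arity = λ _ → k ; Holds = Clause ; code = toList }

_-NAE : ℕ → Language
k -NAE = record
  { Name = SignPattern k ; arity = λ _ → k ; Holds = NAE ; code = toList }

------------------------------------------------------------------------
-- Abduction

Var : Set
Var = ℕ

Assignment : Set
Assignment = Var → Bool

data Literal : Set where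
  pos neg : Var → Literal

litValue : Assignment → Literal → Bool
litValue σ (pos x) = σ x
litValue σ (neg x) = not (σ x)

letter : Bool → Letter
letter b = if b then 𝟙 else 𝟘

-- Bijective base two, most significant digit first: 𝟘 stands for the
-- digit one and 𝟙 for the digit two.
binary : ℕᵇ → List Letter
binary ℕᵇ.zero  = []
binary 2[1+ n ] = binary n ++ [ 𝟙 ]
binary 1+[2 n ] = binary n ++ [ 𝟘 ]

encodeVars : List Var → List Letter
encodeVars = concatMap (λ x → binary (fromℕ x) ++ [ comma ])

module _ (Γ : Language) where
  open Language Γ

  -- Variables may be repeated within a constraint.
  Constraint : Set
  Constraint = Σ Name λ R → Vec Var (arity R)

  Formula : Set
  Formula = List Constraint

  -- The lists H and M stand for the sets of their elements.
  record AbdInstance : Set where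
    constructor abd
    field
      KB : Formula
      H  : List Var
      M  : List Var

module _ {Γ : Language} where
  open Language Γ
  open AbdInstance

  Satisfies : Assignment → Formula Γ → Set
  Satisfies σ = All (λ (R , xs) → Holds R (Vec.map σ xs))

  Model : Formula Γ → List Literal → Assignment → Set
  Model φ E σ = Satisfies σ φ × All (λ l → litValue σ l ≡ true) E

  record Explains (I : AbdInstance Γ) (E : List Literal) : Set where
    field
      overH       : E ⊆ map pos (H I) ++ map neg (H I)
      satisfiable : ∃[ σ ] Model (KB I) E σ
      entails     : ∀ {m} → m ∈ M I → ∀ σ → Model (KB I) E σ → σ m ≡ true

  allVars : AbdInstance Γ → List Var
  allVars I = concatMap (λ (_ , xs) → toList xs) (KB I) ++ H I ++ M I

  encodeConstraint : Constraint Γ → List Letter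
  encodeConstraint (R , xs) =
    map letter (code R) ++ colon ∷ encodeVars (toList xs) ++ [ semicolon ]

  encodeInstance : AbdInstance Γ → List Letter
  encodeInstance I = concatMap encodeConstraint (KB I) ++ slash ∷
                     encodeVars (H I) ++ slash ∷ encodeVars (M I)

ABD : Language → Problem
ABD Γ = record
  { Instance = AbdInstance Γ
  ; encode   = encodeInstance
  ; ∣var_∣   = λ I → length (deduplicate _≟_ (allVars I))
  ; Yes      = λ I → ∃[ E ] Explains I E
  }

P-ABD : Language → Problem
P-ABD Γ = record (ABD Γ)
  { Yes = λ I → ∃[ E ] (Explains I E × E ⊆ map pos (AbdInstance.H I)) }

{-# OPTIONS --safe #-}

-- With a fresh variable z, the constraint NAE(l₁, …, lₖ, ¬z) is equivalent to
-- the clause l₁ ∨ … ∨ lₖ as soon as z = 1.  Since z is put into both H and M,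
-- an explanation may assume z and has to entail it, so explanations of the
-- two instances correspond by adding and removing z.
--
-- The old variables are renamed by x ↦ 1 + 2x, which leaves z = 0 free.  In
-- bijective base two, 1 + 2x is x followed by the digit 𝟘 and 0 is the empty
-- word, so on encodings the whole reduction is a letter-by-letter
-- substitution of words of length at most two.

module Submission where

open import Defs
open import Data.Bool.Base using (Bool; true; false; not; _xor_; if_then_else_)
import Data.Bool.Properties as Bool
open import Data.Fin.Base using (zero; suc; inject₁; fromℕ)
open import Data.Fin.Properties using (2↔Bool; any?)
open import Data.List.Base using (List; []; _∷_; _++_; [_]; map; concatMap; length; reverse; catMaybes; deduplicate; filter)
open import Data.List.Membership.Propositional using (_∈_)
open import Data.List.Membership.Propositional.Properties using (∈-map⁺; ∈-map⁻; ∈-++⁺ˡ; ∈-++⁺ʳ; ∈-++⁻; ∈-∃++; ∈-filter⁺; ∈-filter⁻; ∈-deduplicate⁺; ∈-deduplicate⁻)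
import Data.List.Membership.DecPropositional as DecMembership
open import Data.List.Properties using (concatMap-++; map-++; catMaybes-++; map-catMaybes; unfold-reverse; ++-assoc; length-++; length-map)
open import Data.List.Relation.Binary.Subset.Propositional using (_⊆_)
open import Data.List.Relation.Unary.All as All using (All; []; _∷_)
import Data.List.Relation.Unary.All.Properties as All
open import Data.List.Relation.Unary.Any using (here; there)
open import Data.List.Relation.Unary.Unique.Propositional using (Unique; []; _∷_)
open import Data.List.Relation.Unary.Unique.DecPropositional.Properties using (deduplicate-!)
open import Data.Maybe.Base as Maybe using (Maybe; just; nothing)
open import Data.Nat.Base using (ℕ; suc; _+_; _*_; _^_; _≤_; z≤n; s≤s; ⌊_/2⌋)
open import Data.Nat.Binary.Base using (2[1+_]; 1+[2_])
import Data.Nat.Binary.Base as ℕᵇ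
import Data.Nat.Binary.Properties as ℕᵇ
open import Data.Nat.Properties using (_≟_; ≤-trans; ≤-reflexive; m≤m+n; +-comm; +-suc; +-identityʳ; *-comm; *-identityʳ; n≡⌊n+n/2⌋)
open import Data.Product.Base using (∃-syntax; _×_; _,_; proj₁; proj₂)
open import Data.Sum.Base using (inj₁; inj₂)
open import Data.Vec.Base as Vec using (Vec; []; _∷_; _∷ʳ_; lookup; toList)
import Data.Vec.Properties as Vec
open import Function.Base using (_∘_; case_of_)
open import Function.Bundles using (_⇔_; mk⇔; Equivalence)
open import Function.Construct.Symmetry using (↔-sym)
open import Relation.Binary.PropositionalEquality using (_≡_; _≗_; refl; sym; trans; cong; cong₂; subst; module ≡-Reasoning)
open import Relation.Nullary using (Dec; yes; no; contradiction)
open import Relation.Nullary.Decidable using (map′)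

open ≡-Reasoning

-- Letter substitutions run in linear time

module Substitution {A : Set} (emit : Bool → A → Maybe A) where

  image : A → List A
  image a = catMaybes (emit false a ∷ emit true a ∷ [])

  -- The state tells which of the two letters of the image is due next.
  -- Missing letters are written as blanks, which `contents` ignores.
  machine : TuringMachine A
  machine = record
    { State        = Bool
    ; state-finite = 2 , ↔-sym 2↔Bool
    ; auxSymbols   = 0
    ; workTapes    = 0
    ; start        = false
    ; δ            = λ where
        q (nothing ∷ _)       → nothing
        q (just (inj₂ ()) ∷ _)
        q (just (inj₁ a) ∷ _) → just
          ( not q
          , (just (inj₁ a) , (if q then right else stay))
          ∷ (Maybe.map inj₁ (emit q a) , right)
          ∷ [])
    }

  open TuringMachine machine

  -- Both `wordTape` and a move to the right distinguish an empty remainder from a non-empty one;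
  -- this form of the input tape covers the two cases, with the cells already read in `ls`.
  scanning : List (Maybe Symbol) → List Symbol → Tape Symbol
  scanning ls []       = tape ls nothing []
  scanning ls (a ∷ as) = tape ls (just a) (map just as)

  wordTape≡scanning : ∀ w → wordTape w ≡ scanning [] w
  wordTape≡scanning []      = refl
  wordTape≡scanning (_ ∷ _) = refl

  move-scanning : ∀ ls a as → move right (scanning ls (a ∷ as)) ≡ scanning (just a ∷ ls) as
  move-scanning ls a []      = refl
  move-scanning ls a (_ ∷ _) = refl

  atLetter : List (Maybe Symbol) → List A → List (Maybe Symbol) → Config
  atLetter ls w out = false , scanning ls (map inj₁ w) ∷ tape out nothing [] ∷ []

  contents-reverse : ∀ (c d : Maybe Symbol) out →
    catMaybes (reverse (d ∷ c ∷ out)) ≡ catMaybes (reverse out) ++ catMaybes (c ∷ d ∷ [])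
  contents-reverse c d out = begin
    catMaybes (reverse (d ∷ c ∷ out))             ≡⟨ cong catMaybes (unfold-reverse d (c ∷ out)) ⟩
    catMaybes (reverse (c ∷ out) ++ [ d ])        ≡⟨ cong (λ z → catMaybes (z ++ [ d ])) (unfold-reverse c out) ⟩
    catMaybes ((reverse out ++ [ c ]) ++ [ d ])   ≡⟨ cong catMaybes (++-assoc (reverse out) [ c ] [ d ]) ⟩
    catMaybes (reverse out ++ c ∷ d ∷ [])         ≡⟨ catMaybes-++ (reverse out) (c ∷ d ∷ []) ⟩
    catMaybes (reverse out) ++ catMaybes (c ∷ d ∷ []) ∎

  -- Induction on `w`, with `ls` and `out` general because both grow with each letter. The final
  -- output head rests on a blank, which `catMaybes` drops.
  run : ∀ ls w out → ∃[ d ] (atLetter ls w out ⇓[ length w * 2 ] d ×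
    output d ≡ catMaybes (reverse out) ++ map inj₁ (concatMap image w))
  run ls []      out = _ , halt refl , catMaybes-++ (reverse out) [ nothing ]
  run ls (a ∷ w) out =
    let symbol : Bool → Maybe Symbol
        symbol q = Maybe.map inj₁ (emit q a)
        c = symbol false
        e = symbol true
        d , steps , eq = run (just (inj₁ a) ∷ ls) w (e ∷ c ∷ out)
    in d
     -- The first step leaves the input head in place and computes outright; the result of the
     -- second depends on whether `w` is empty, hence `move-scanning`.
     , next refl (next (cong (λ t → just (false , t ∷ tape (e ∷ c ∷ out) nothing [] ∷ []))
                             (move-scanning ls (inj₁ a) (map inj₁ w)))
                       steps)
     , (begin
         output d
           ≡⟨ eq ⟩
         catMaybes (reverse (e ∷ c ∷ out)) ++ map inj₁ (concatMap image w)
           ≡⟨ cong (_++ _) (contents-reverse c e out) ⟩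
         (catMaybes (reverse out) ++ catMaybes (c ∷ e ∷ [])) ++ map inj₁ (concatMap image w)
           ≡⟨ ++-assoc (catMaybes (reverse out)) _ _ ⟩
         catMaybes (reverse out) ++ (catMaybes (c ∷ e ∷ []) ++ map inj₁ (concatMap image w))
           ≡⟨ cong (λ z → catMaybes (reverse out) ++ (z ++ _)) (map-catMaybes inj₁ (emit false a ∷ emit true a ∷ [])) ⟨
         catMaybes (reverse out) ++ (map inj₁ (image a) ++ map inj₁ (concatMap image w))
           ≡⟨ cong (catMaybes (reverse out) ++_) (map-++ inj₁ (image a) (concatMap image w)) ⟨
         catMaybes (reverse out) ++ map inj₁ (concatMap image (a ∷ w)) ∎)

  polyTime : ∀ {X Y : Set} (encX : X → List A) (encY : Y → List A) (f : X → Y) →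
    (∀ x → encY (f x) ≡ concatMap image (encX x)) → PolyTime encX encY f
  -- Two steps per letter give exactly 2n, below the bound 2 * n ^ 1 + 2.
  polyTime encX encY f encode-f = machine , 2 , 1 , λ x →
    let w              = encX x
        d , steps , eq = run [] w []
    in length w * 2 , d
     , subst (λ t → (false , t ∷ blankTape ∷ []) ⇓[ length w * 2 ] d)
             (sym (wordTape≡scanning (map inj₁ w))) steps
     , ≤-trans (≤-reflexive (trans (*-comm (length w) 2) (cong (2 *_) (sym (*-identityʳ (length w))))))
               (m≤m+n (2 * length w ^ 1) 2)
     , trans eq (cong (map inj₁) (sym (encode-f x)))

-- Clauses as not-all-equal constraints

lookup-∷ʳ-inject₁ : ∀ {A : Set} {n} (xs : Vec A n) x i → lookup (xs ∷ʳ x) (inject₁ i) ≡ lookup xs i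
lookup-∷ʳ-inject₁ (_ ∷ _)  x zero    = refl
lookup-∷ʳ-inject₁ (_ ∷ xs) x (suc i) = lookup-∷ʳ-inject₁ xs x i

lookup-∷ʳ-fromℕ : ∀ {A : Set} {n} (xs : Vec A n) x → lookup (xs ∷ʳ x) (fromℕ n) ≡ x
lookup-∷ʳ-fromℕ []       x = refl
lookup-∷ʳ-fromℕ (_ ∷ xs) x = lookup-∷ʳ-fromℕ xs x

Is0-∷ʳ : ∀ {k} (s a : Vec Bool k) → Is0 s a → Is0 (s ∷ʳ true) (a ∷ʳ true)
Is0-∷ʳ []      []      all0 zero    = refl
Is0-∷ʳ (_ ∷ _) (_ ∷ _) all0 zero    = all0 zero
Is0-∷ʳ (_ ∷ s) (_ ∷ a) all0 (suc i) = Is0-∷ʳ s a (all0 ∘ suc) i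

-- The last literal has the value true xor true = false. This already excludes `Is1`, and `Is0` then
-- says that all literals of the clause are false.
NAE⇔Clause : ∀ {k} (s a : Vec Bool k) → NAE (s ∷ʳ true) (a ∷ʳ true) ⇔ Clause s a
NAE⇔Clause {k} s a = mk⇔ to from
  where
  to : NAE (s ∷ʳ true) (a ∷ʳ true) → Clause s a
  -- A clause asks for a true literal as witness, so the finitely many positions are searched.
  to (¬all0 , _) with any? (λ i → lookup s i xor lookup a i Bool.≟ true)
  ... | yes clause = clause
  ... | no  ¬clause = contradiction
    (Is0-∷ʳ s a λ i → Bool.¬-not λ eq → ¬clause (i , eq)) ¬all0

  from : Clause s a → NAE (s ∷ʳ true) (a ∷ʳ true)
  from (i , eq) =
      (λ all0 → case trans (sym eq) (trans (sym (cong₂ _xor_ (lookup-∷ʳ-inject₁ s true i) (lookup-∷ʳ-inject₁ a true i))) (all0 (inject₁ i))) of λ ())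
    , (λ all1 → case trans (sym (all1 (fromℕ k))) (cong₂ _xor_ (lookup-∷ʳ-fromℕ s true) (lookup-∷ʳ-fromℕ a true)) of λ ())

-- The reduction

rename : Var → Var
rename x = suc (2 * x)

renameLiteral : Literal → Literal
renameLiteral (pos x) = pos (rename x)
renameLiteral (neg x) = neg (rename x)

-- Makes z true and undoes `rename` by halving. A positive even number is not a renamed variable; it
-- gets the value of its odd predecessor.
extend : Assignment → Assignment
extend σ 0       = true
extend σ (suc y) = σ ⌊ y /2⌋

extend-rename : ∀ σ → extend σ ∘ rename ≗ σ
extend-rename σ x = cong σ (sym (trans (n≡⌊n+n/2⌋ x) (cong (λ y → ⌊ x + y /2⌋) (sym (+-identityʳ x)))))

litValue-rename : ∀ σ l → litValue σ (renameLiteral l) ≡ litValue (σ ∘ rename) l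
litValue-rename σ (pos x) = refl
litValue-rename σ (neg x) = refl

litValue-cong : ∀ {σ τ} → σ ≗ τ → litValue σ ≗ litValue τ
litValue-cong σ≗τ (pos x) = σ≗τ x
litValue-cong σ≗τ (neg x) = cong not (σ≗τ x)

-- `extend-rename` is an equality at each variable only, so satisfaction has to be carried along it.
Satisfies-cong : ∀ Γ {σ τ} → σ ≗ τ → {φ : Formula Γ} → Satisfies {Γ} σ φ → Satisfies {Γ} τ φ
Satisfies-cong Γ σ≗τ = All.map λ {c} → subst (Language.Holds Γ (proj₁ c)) (Vec.map-cong σ≗τ (proj₂ c))

module _ {k : ℕ} where

  naeConstraint : Constraint (k -CNF) → Constraint (suc k -NAE)
  naeConstraint (s , xs) = s ∷ʳ true , Vec.map rename xs ∷ʳ 0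

  naeInstance : AbdInstance (k -CNF) → AbdInstance (suc k -NAE)
  naeInstance (abd KB H M) = abd (map naeConstraint KB) (0 ∷ map rename H) (0 ∷ map rename M)

  map-renamed : ∀ (σ : Assignment) → σ 0 ≡ true → (xs : Vec Var k) →
    Vec.map σ (Vec.map rename xs ∷ʳ 0) ≡ Vec.map (σ ∘ rename) xs ∷ʳ true
  map-renamed σ σ0 xs = begin
    Vec.map σ (Vec.map rename xs ∷ʳ 0)         ≡⟨ Vec.map-∷ʳ σ 0 (Vec.map rename xs) ⟩
    Vec.map σ (Vec.map rename xs) ∷ʳ σ 0       ≡⟨ cong₂ _∷ʳ_ (sym (Vec.map-∘ σ rename xs)) σ0 ⟩
    Vec.map (σ ∘ rename) xs ∷ʳ true            ∎

  -- Stated for every assignment with z true, because it is applied to arbitrary models of the new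
  -- instance and not just to those of the form `extend σ`.
  Satisfies-nae⁻ : ∀ σ → σ 0 ≡ true → ∀ φ →
    Satisfies {suc k -NAE} σ (map naeConstraint φ) → Satisfies {k -CNF} (σ ∘ rename) φ
  Satisfies-nae⁻ σ σ0 φ = All.map (λ {(s , xs)} holds → Equivalence.to (NAE⇔Clause s (Vec.map (σ ∘ rename) xs))
    (subst (NAE (s ∷ʳ true)) (map-renamed σ σ0 xs) holds)) ∘ All.map⁻

  Satisfies-nae⁺ : ∀ σ → σ 0 ≡ true → ∀ φ →
    Satisfies {k -CNF} (σ ∘ rename) φ → Satisfies {suc k -NAE} σ (map naeConstraint φ)
  Satisfies-nae⁺ σ σ0 φ = All.map⁺ ∘ All.map (λ {(s , xs)} holds →
    subst (NAE (s ∷ʳ true)) (sym (map-renamed σ σ0 xs)) (Equivalence.from (NAE⇔Clause s (Vec.map (σ ∘ rename) xs)) holds))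

-- Correctness

pos-injective : ∀ {x y} → pos x ≡ pos y → x ≡ y
pos-injective refl = refl

neg-injective : ∀ {x y} → neg x ≡ neg y → x ≡ y
neg-injective refl = refl

_≟ˡ_ : (l l′ : Literal) → Dec (l ≡ l′)
pos x ≟ˡ pos y = map′ (cong pos) pos-injective (x ≟ y)
pos x ≟ˡ neg y = no λ ()
neg x ≟ˡ pos y = no λ ()
neg x ≟ˡ neg y = map′ (cong neg) neg-injective (x ≟ y)

open DecMembership _≟ˡ_ using (_∈?_)

literals : List Var → List Literal
literals H = map pos H ++ map neg H

renamed-pos : ∀ {l H} → l ∈ map pos H → renameLiteral l ∈ map pos (0 ∷ map rename H)
renamed-pos l∈ with x , x∈H , refl ← ∈-map⁻ pos l∈ = there (∈-map⁺ pos (∈-map⁺ rename x∈H))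

renamed-neg : ∀ {l H} → l ∈ map neg H → renameLiteral l ∈ map neg (0 ∷ map rename H)
renamed-neg l∈ with x , x∈H , refl ← ∈-map⁻ neg l∈ = there (∈-map⁺ neg (∈-map⁺ rename x∈H))

renamed-literal : ∀ {l} H → l ∈ literals H → renameLiteral l ∈ literals (0 ∷ map rename H)
renamed-literal H l∈ with ∈-++⁻ (map pos H) l∈
... | inj₁ l∈pos = ∈-++⁺ˡ (renamed-pos l∈pos)
... | inj₂ l∈neg = ∈-++⁺ʳ (map pos (0 ∷ map rename H)) (renamed-neg l∈neg)

data NewLiteral (H : List Var) : Literal → Set where
  fresh⁺  : NewLiteral H (pos 0)
  fresh⁻  : NewLiteral H (neg 0)
  renamed : ∀ {l} → l ∈ literals H → NewLiteral H (renameLiteral l)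

newLiteral : ∀ {l} H → l ∈ literals (0 ∷ map rename H) → NewLiteral H l
newLiteral H l∈ with ∈-++⁻ (map pos (0 ∷ map rename H)) l∈
... | inj₁ (here refl) = fresh⁺
... | inj₂ (here refl) = fresh⁻
... | inj₁ (there l∈pos)
  with _ , y∈ , refl ← ∈-map⁻ pos l∈pos
  with x , x∈H , refl ← ∈-map⁻ rename y∈ = renamed (∈-++⁺ˡ (∈-map⁺ pos x∈H))
... | inj₂ (there l∈neg)
  with _ , y∈ , refl ← ∈-map⁻ neg l∈neg
  with x , x∈H , refl ← ∈-map⁻ rename y∈ = renamed (∈-++⁺ʳ (map pos H) (∈-map⁺ neg x∈H))

module _ {k : ℕ} (I : AbdInstance (k -CNF)) where
  open AbdInstance I

  addFresh : List Literal → List Literal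
  addFresh E = pos 0 ∷ map renameLiteral E

  addFresh-positive : ∀ {E} → E ⊆ map pos H → addFresh E ⊆ map pos (0 ∷ map rename H)
  addFresh-positive E⊆ (here refl) = here refl
  addFresh-positive E⊆ (there l∈)
    with l , l∈E , refl ← ∈-map⁻ renameLiteral l∈ = renamed-pos (E⊆ l∈E)

  -- Old models pass to new ones by `extend`, which gives satisfiability. Conversely `pos 0` makes z
  -- true in each new model, so composing with `rename` yields an old model, where `M` is entailed.
  addFresh-explains : ∀ {E} → Explains I E → Explains (naeInstance I) (addFresh E)
  addFresh-explains {E} expl = record
    { overH = λ where
        (here refl) → here refl
        (there l∈)  → let l , l∈E , eq = ∈-map⁻ renameLiteral l∈
                      in subst (_∈ _) (sym eq) (renamed-literal H (overH l∈E))
    ; satisfiable =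
        let σ , sat , lits = satisfiable
            ≗σ = extend-rename σ
        in extend σ
         , Satisfies-nae⁺ (extend σ) refl KB (Satisfies-cong (k -CNF) (sym ∘ ≗σ) sat)
         , refl ∷ All.map⁺ (All.map (λ {l} → trans (trans (litValue-rename (extend σ) l) (litValue-cong ≗σ l))) lits)
    ; entails = λ where
        (here refl) σ (_ , σ0 ∷ _) → σ0
        (there m∈) σ (sat , σ0 ∷ lits) →
          let m , m∈M , eq = ∈-map⁻ rename m∈
          in trans (cong σ eq) (entails m∈M (σ ∘ rename)
               ( Satisfies-nae⁻ σ σ0 KB sat
               , All.map (λ {l} → trans (sym (litValue-rename σ l))) (All.map⁻ lits)))
    }
    where open Explains expl

  -- Selecting among the old literals, instead of inverting `renameLiteral` on `E`, makes `overH`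
  -- immediate and discards both literals of z.
  dropFresh : List Literal → List Literal
  dropFresh E = filter (λ l → renameLiteral l ∈? E) (literals H)

  -- Renaming preserves polarity, so a negative literal that is kept would put a negative literal
  -- into `E`.
  dropFresh-positive : ∀ {E} → E ⊆ map pos (0 ∷ map rename H) → dropFresh E ⊆ map pos H
  dropFresh-positive {E} E⊆ l∈
    with l∈H , rl∈E ← ∈-filter⁻ (λ l → renameLiteral l ∈? E) l∈
    with ∈-++⁻ (map pos H) l∈H
  ... | inj₁ l∈pos = l∈pos
  ... | inj₂ l∈neg
    with _ , _ , refl ← ∈-map⁻ neg l∈neg
    with _ , _ , () ← ∈-map⁻ pos (E⊆ rl∈E)

  dropFresh-explains : ∀ {E} → Explains (naeInstance I) E → Explains I (dropFresh E)
  dropFresh-explains {E} expl = record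
    { overH       = proj₁ ∘ ∈-filter⁻ kept?
    ; satisfiable = τ ∘ rename , Satisfies-nae⁻ τ τ0 KB τ⊨KB ,
        All.tabulate λ {l} l∈ →
          trans (sym (litValue-rename τ l)) (All.lookup τ⊨E (proj₂ (∈-filter⁻ kept? {xs = literals H} l∈)))
    ; entails     = λ {m} m∈M σ (sat , lits) →
        let ≗σ = extend-rename σ
            value : ∀ {l} → NewLiteral H l → l ∈ E → litValue (extend σ) l ≡ true
            value = λ where
              fresh⁺ _            → refl
              -- The hypotheses also permit `neg 0`, but `E` has the model `τ`, in which z is true.
              fresh⁻ l∈E          → contradiction (trans (sym (All.lookup τ⊨E l∈E)) (cong not τ0)) λ ()
              (renamed {l} l∈H) l∈E → trans (trans (litValue-rename (extend σ) l) (litValue-cong ≗σ l))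
                                          (All.lookup lits (∈-filter⁺ kept? l∈H l∈E))
        in trans (sym (≗σ m)) (entails (there (∈-map⁺ rename m∈M)) (extend σ)
             ( Satisfies-nae⁺ (extend σ) refl KB (Satisfies-cong (k -CNF) (sym ∘ ≗σ) sat)
             , All.tabulate (λ l∈E → value (newLiteral H (overH l∈E)) l∈E)))
    }
    where
    open Explains expl
    kept? = λ l → renameLiteral l ∈? E
    τ = proj₁ satisfiable
    τ⊨KB = proj₁ (proj₂ satisfiable)
    τ⊨E = proj₂ (proj₂ satisfiable)
    -- `E` may lack `pos 0`; z is nevertheless true in each model of `E` and the knowledge base,
    -- being one of the variables to be entailed.
    τ0 : τ 0 ≡ true
    τ0 = entails (here refl) τ (τ⊨KB , τ⊨E)

-- Number of variables

-- Pigeonhole: delete one occurrence of `x` from `ys`. By uniqueness the rest of `xs` avoids `x`, so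
-- it is still contained in what remains.
Unique-⊆⇒length≤ : ∀ {A : Set} {xs ys : List A} → Unique xs → xs ⊆ ys → length xs ≤ length ys
Unique-⊆⇒length≤ []           xs⊆ys = z≤n
Unique-⊆⇒length≤ {xs = x ∷ xs} (x∉xs ∷ uniq) xs⊆ys
  with as , bs , refl ← ∈-∃++ (xs⊆ys (here refl)) =
  ≤-trans (s≤s (Unique-⊆⇒length≤ uniq xs⊆as++bs))
          (≤-reflexive (trans (cong suc (length-++ as)) (trans (sym (+-suc (length as) (length bs))) (sym (length-++ as)))))
  where
  xs⊆as++bs : xs ⊆ as ++ bs
  xs⊆as++bs y∈xs with ∈-++⁻ as (xs⊆ys (there y∈xs))
  ... | inj₁ y∈as         = ∈-++⁺ˡ y∈as
  ... | inj₂ (here refl)  = contradiction refl (All.lookup x∉xs y∈xs)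
  ... | inj₂ (there y∈bs) = ∈-++⁺ʳ as y∈bs

toList-renamed : ∀ {n} (xs : Vec Var n) →
  toList (Vec.map rename xs ∷ʳ 0) ≡ map rename (toList xs) ++ [ 0 ]
toList-renamed xs = trans (Vec.toList-∷ʳ 0 (Vec.map rename xs)) (cong (_++ [ 0 ]) (Vec.toList-map rename xs))

-- The two copies of `0` merge into one, so the whole instance gains a single variable rather than
-- one for each constraint.
++-⊆-renamed : ∀ {A B : List Var} {as bs : List Var} →
  A ⊆ 0 ∷ map rename as → B ⊆ 0 ∷ map rename bs → A ++ B ⊆ 0 ∷ map rename (as ++ bs)
++-⊆-renamed {A} {as = as} {bs} A⊆ B⊆ x∈ with ∈-++⁻ A x∈
++-⊆-renamed {as = as} {bs} A⊆ B⊆ x∈ | inj₁ x∈A with A⊆ x∈A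
... | here eq  = here eq
... | there x∈ = there (subst (_ ∈_) (sym (map-++ rename as bs)) (∈-++⁺ˡ x∈))
++-⊆-renamed {as = as} {bs} A⊆ B⊆ x∈ | inj₂ x∈B with B⊆ x∈B
... | here eq  = here eq
... | there x∈ = there (subst (_ ∈_) (sym (map-++ rename as bs)) (∈-++⁺ʳ (map rename as) x∈))

module _ {k : ℕ} where

  varsKB-nae : ∀ (φ : Formula (k -CNF)) →
    concatMap (λ (_ , xs) → toList xs) (map naeConstraint φ) ⊆
    0 ∷ map rename (concatMap (λ (_ , xs) → toList xs) φ)
  varsKB-nae []             ()
  varsKB-nae ((s , xs) ∷ φ) = ++-⊆-renamed {as = toList xs} vars-xs (varsKB-nae φ)
    where
    vars-xs : toList (Vec.map rename xs ∷ʳ 0) ⊆ 0 ∷ map rename (toList xs)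
    vars-xs x∈ with ∈-++⁻ (map rename (toList xs)) (subst (_ ∈_) (toList-renamed xs) x∈)
    ... | inj₁ x∈xs      = there x∈xs
    ... | inj₂ (here eq) = here eq

  allVars-nae : ∀ (I : AbdInstance (k -CNF)) → allVars (naeInstance I) ⊆ 0 ∷ map rename (allVars I)
  allVars-nae (abd KB H M) = ++-⊆-renamed {as = concatMap (λ (_ , xs) → toList xs) KB} (varsKB-nae KB)
    (++-⊆-renamed {A = 0 ∷ map rename H} {as = H} (λ x∈ → x∈) (λ x∈ → x∈))

  fewVars-nae : ∀ (I : AbdInstance (k -CNF)) →
    length (deduplicate _≟_ (allVars (naeInstance I))) ≤ length (deduplicate _≟_ (allVars I)) + 1
  fewVars-nae I = ≤-trans
    (Unique-⊆⇒length≤ (deduplicate-! _≟_ (allVars (naeInstance I))) ⊆new)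
    (≤-reflexive (trans (cong suc (length-map rename old)) (+-comm 1 (length old))))
    where
    old = deduplicate _≟_ (allVars I)
    ⊆new : deduplicate _≟_ (allVars (naeInstance I)) ⊆ 0 ∷ map rename old
    ⊆new y∈ with allVars-nae I (∈-deduplicate⁻ _≟_ (allVars (naeInstance I)) y∈)
    ... | here eq  = here eq
    ... | there y∈ with x , x∈ , refl ← ∈-map⁻ rename y∈ = there (∈-map⁺ rename (∈-deduplicate⁺ _≟_ x∈))

-- Encodings

-- The additional letters are the last digit of 1 + 2x, the sign of z, and z
-- itself at the end of a constraint and at the start of H and of M.
emit : Bool → Letter → Maybe Letter
emit false comma     = just 𝟘
emit true  comma     = just comma
emit false colon     = just 𝟙
emit true  colon     = just colon
emit false semicolon = just comma
emit true  semicolon = just semicolon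
emit false slash     = just slash
emit true  slash     = just comma
emit false a         = just a
emit true  a         = nothing

open Substitution emit using (image; polyTime)

image* : List Letter → List Letter
image* = concatMap image

image*-++ : ∀ u v → image* (u ++ v) ≡ image* u ++ image* v
image*-++ = concatMap-++ image

image*-bits : ∀ bs → image* (map letter bs) ≡ map letter bs
image*-bits []           = refl
image*-bits (true  ∷ bs) = cong (𝟙 ∷_) (image*-bits bs)
image*-bits (false ∷ bs) = cong (𝟘 ∷_) (image*-bits bs)

image*-binary : ∀ n → image* (binary n) ≡ binary n
image*-binary ℕᵇ.zero  = refl
image*-binary 2[1+ n ] = trans (image*-++ (binary n) [ 𝟙 ]) (cong (_++ [ 𝟙 ]) (image*-binary n))
image*-binary 1+[2 n ] = trans (image*-++ (binary n) [ 𝟘 ]) (cong (_++ [ 𝟘 ]) (image*-binary n))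

-- After `toℕ`, the constructor `1+[2_]` unfolds to `rename`, so both sides are compared as unary
-- numbers.
fromℕ-rename : ∀ x → ℕᵇ.fromℕ (rename x) ≡ 1+[2 ℕᵇ.fromℕ x ]
fromℕ-rename x = ℕᵇ.toℕ-injective (trans (ℕᵇ.toℕ-fromℕ (rename x)) (cong rename (sym (ℕᵇ.toℕ-fromℕ x))))

image*-vars : ∀ xs → image* (encodeVars xs) ≡ encodeVars (map rename xs)
image*-vars []       = refl
image*-vars (x ∷ xs) = begin
  image* ((b ++ [ comma ]) ++ encodeVars xs)                ≡⟨ image*-++ (b ++ [ comma ]) (encodeVars xs) ⟩
  image* (b ++ [ comma ]) ++ image* (encodeVars xs)         ≡⟨ cong₂ _++_ (image*-++ b [ comma ]) (image*-vars xs) ⟩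
  (image* b ++ 𝟘 ∷ comma ∷ []) ++ encodeVars (map rename xs) ≡⟨ cong (λ u → (u ++ 𝟘 ∷ comma ∷ []) ++ _) (image*-binary (ℕᵇ.fromℕ x)) ⟩
  -- Reassociation moves `𝟘` from the image of the separator to the number, as its last digit.
  (b ++ 𝟘 ∷ comma ∷ []) ++ encodeVars (map rename xs)       ≡⟨ cong (_++ _) (++-assoc b [ 𝟘 ] [ comma ]) ⟨
  (binary 1+[2 ℕᵇ.fromℕ x ] ++ [ comma ]) ++ encodeVars (map rename xs) ≡⟨ cong (λ n → (binary n ++ [ comma ]) ++ _) (fromℕ-rename x) ⟨
  encodeVars (map rename (x ∷ xs))                          ∎
  where b = binary (ℕᵇ.fromℕ x)

module _ {k : ℕ} where

  image*-constraint : ∀ (c : Constraint (k -CNF)) →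
    encodeConstraint {suc k -NAE} (naeConstraint c) ≡ image* (encodeConstraint {k -CNF} c)
  image*-constraint (s , xs) = begin
    map letter (toList (s ∷ʳ true)) ++ colon ∷ encodeVars (toList (Vec.map rename xs ∷ʳ 0)) ++ [ semicolon ]
      ≡⟨ cong₂ (λ u v → map letter u ++ colon ∷ encodeVars v ++ [ semicolon ]) (Vec.toList-∷ʳ true s) (toList-renamed xs) ⟩
    map letter (toList s ++ [ true ]) ++ colon ∷ encodeVars (map rename (toList xs) ++ [ 0 ]) ++ [ semicolon ]
      -- The variable 0 has the empty word as its numeral, so it contributes a lone comma.
      ≡⟨ cong₂ (λ u v → u ++ colon ∷ v ++ [ semicolon ]) (map-++ letter (toList s) [ true ]) (concatMap-++ _ (map rename (toList xs)) [ 0 ]) ⟩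
    (bits ++ [ 𝟙 ]) ++ colon ∷ (encodeVars (map rename (toList xs)) ++ [ comma ]) ++ [ semicolon ]
      ≡⟨ ++-assoc bits [ 𝟙 ] _ ⟩
    bits ++ 𝟙 ∷ colon ∷ (encodeVars (map rename (toList xs)) ++ [ comma ]) ++ [ semicolon ]
      ≡⟨ cong (λ u → bits ++ 𝟙 ∷ colon ∷ u) (++-assoc (encodeVars (map rename (toList xs))) [ comma ] [ semicolon ]) ⟩
    bits ++ 𝟙 ∷ colon ∷ encodeVars (map rename (toList xs)) ++ comma ∷ semicolon ∷ []
      ≡⟨ cong₂ (λ u v → u ++ 𝟙 ∷ colon ∷ v ++ comma ∷ semicolon ∷ []) (image*-bits (toList s)) (image*-vars (toList xs)) ⟨
    image* bits ++ 𝟙 ∷ colon ∷ image* (encodeVars (toList xs)) ++ comma ∷ semicolon ∷ []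
      ≡⟨ cong (λ u → image* bits ++ 𝟙 ∷ colon ∷ u) (image*-++ (encodeVars (toList xs)) [ semicolon ]) ⟨
    image* bits ++ image* (colon ∷ encodeVars (toList xs) ++ [ semicolon ])
      ≡⟨ image*-++ bits _ ⟨
    image* (bits ++ colon ∷ encodeVars (toList xs) ++ [ semicolon ]) ∎
    where bits = map letter (toList s)

  image*-KB : ∀ (φ : Formula (k -CNF)) →
    concatMap (encodeConstraint {suc k -NAE}) (map naeConstraint φ) ≡ image* (concatMap (encodeConstraint {k -CNF}) φ)
  image*-KB []      = refl
  image*-KB (c ∷ φ) = trans (cong₂ _++_ (image*-constraint c) (image*-KB φ)) (sym (image*-++ (encodeConstraint {k -CNF} c) _))

  encode-nae : ∀ (I : AbdInstance (k -CNF)) → encodeInstance (naeInstance I) ≡ image* (encodeInstance I)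
  encode-nae (abd KB H M) = begin
    -- As z heads both lists, its comma directly follows each slash, and `slash ∷ comma` is the
    -- image of `slash`.
    concatMap (encodeConstraint {suc k -NAE}) (map naeConstraint KB) ++ slash ∷ comma ∷ encodeVars (map rename H) ++ slash ∷ comma ∷ encodeVars (map rename M)
      ≡⟨ cong₂ (λ u v → u ++ slash ∷ comma ∷ v) (image*-KB KB)
               (cong₂ (λ u v → u ++ slash ∷ comma ∷ v) (sym (image*-vars H)) (sym (image*-vars M))) ⟩
    image* kb ++ slash ∷ comma ∷ image* (encodeVars H) ++ slash ∷ comma ∷ image* (encodeVars M)
      ≡⟨ cong (λ u → image* kb ++ slash ∷ comma ∷ u) (image*-++ (encodeVars H) (slash ∷ encodeVars M)) ⟨
    image* kb ++ image* (slash ∷ encodeVars H ++ slash ∷ encodeVars M)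
      ≡⟨ image*-++ kb _ ⟨
    image* (kb ++ slash ∷ encodeVars H ++ slash ∷ encodeVars M) ∎
    where kb = concatMap (encodeConstraint {k -CNF}) KB

theorem29 : ∀ (k : ℕ) → 1 ≤ k → (ABD (k -CNF) ≤CV ABD (suc k -NAE)) × (P-ABD (k -CNF) ≤CV P-ABD (suc k -NAE))
theorem29 k _ =
    record
      { f        = naeInstance
      ; polyTime = polyTime encodeInstance encodeInstance naeInstance encode-nae
      ; correct  = λ I → mk⇔ (λ (E , expl) → addFresh I E , addFresh-explains I expl)
                             (λ (E , expl) → dropFresh I E , dropFresh-explains I expl)
      ; fewVars  = 1 , fewVars-nae
      }
  , record
      { f        = naeInstance
      ; polyTime = polyTime encodeInstance encodeInstance naeInstance encode-nae
      -- The same maps on explanations serve here, since both preserve positivity.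
      ; correct  = λ I → mk⇔ (λ (E , expl , E⊆) → addFresh I E , addFresh-explains I expl , addFresh-positive I E⊆)
                             (λ (E , expl , E⊆) → dropFresh I E , dropFresh-explains I expl , dropFresh-positive I E⊆)
      ; fewVars  = 1 , fewVars-nae
      }
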